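{- The multi-machine Windows Scheduling Problem with unit-size jobs having exact periods and no machine migration allowed can be reduced to the single-machine variant of that problem (unit-size jobs, exact periods) in polynomial time.
   Context: Windows Scheduling Problem: given jobs $j=1,\ldots,n$ with integer periods $p_1,\ldots,p_n$ (and here unit processing length), decide whether there is an infinite non-preemptive schedule in which every job is executed infinitely often. With exact periods, the time between any two consecutive executions (start times) of job $j$ must be exactly $p_j$. In the multi-machine variant there are $m$ machines, each processing at most one job per time slot; with no machine migration, each job must be assigned to a fixed machine on which all its executions take place. The single-machine variant is the case $m=1$. -}

module Defs where

open import Data.Nat using (ℕ; zero; suc; _+_; _*_; _^_; _≤_)
open import Data.Nat.Binary.Base using (ℕᵇ; 2[1+_]; 1+[2_]) renaming (zero to zeroᵇ; fromℕ to toBin)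
open import Data.Fin using (Fin)
open import Data.Integer using (ℤ; +_) renaming (_+_ to _+ℤ_)
import Data.Integer.Properties as ℤP
open import Data.List using (List; []; _∷_; _++_; length; lookup; concatMap)
open import Data.List.Relation.Unary.All using (All)
open import Data.Empty using (⊥)
open import Data.Maybe using (Maybe; just; nothing)
open import Data.Product using (Σ; ∃; _×_; _,_)
open import Relation.Binary.PropositionalEquality using (_≡_; _≢_)
open import Relation.Nullary using (yes; no)

Job : List ℕ → Set
Job ps = Fin (length ps)

period : (ps : List ℕ) → Job ps → ℕ
period ps j = lookup ps j

-- Job with period p and first start time a is executed (started, and,
-- being unit length, processed) in time slot t.  With exact periods the
-- start times are exactly the arithmetic progression a, a+p, a+2p, ...
ExecutesAt : (p a t : ℕ) → Set
ExecutesAt p a t = ∃ λ k → t ≡ a + k * p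

record Schedule (m : ℕ) (ps : List ℕ) : Set where
  field
    machine : Job ps → Fin m
    start   : Job ps → ℕ

-- Validity: every job is executed infinitely often (periods are
-- positive; a period-0 job would run only once), and no machine
-- processes two different jobs in the same time slot.
Valid : (m : ℕ) (ps : List ℕ) → Schedule m ps → Set
Valid m ps S =
  All (λ p → 1 ≤ p) ps ×
  (∀ (i j : Job ps) (t : ℕ) → i ≢ j → machine i ≡ machine j →
     ExecutesAt (period ps i) (start i) t →
     ExecutesAt (period ps j) (start j) t → ⊥)
  where open Schedule S

MultiFeasible : (m : ℕ) → List ℕ → Set
MultiFeasible m ps = Σ (Schedule m ps) (Valid m ps)

SingleFeasible : List ℕ → Set
SingleFeasible ps = MultiFeasible 1 ps

data Ch : Set where
  c0 c1 sep : Ch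

-- Numbers in bijective base 2 (digits 1,2 written c0,c1; least
-- significant digit first); the empty word encodes 0.
encBin : ℕᵇ → List Ch
encBin zeroᵇ     = []
encBin 1+[2 x ]  = c0 ∷ encBin x
encBin 2[1+ x ]  = c1 ∷ encBin x

encNat : ℕ → List Ch
encNat n = encBin (toBin n)

encPeriods : List ℕ → List Ch
encPeriods = concatMap (λ p → sep ∷ encNat p)

encMulti : ℕ → List ℕ → List Ch
encMulti m ps = encNat m ++ encPeriods ps

encSingle : List ℕ → List Ch
encSingle = encPeriods

-- Tape symbols: 0 = blank, 1,2,3 = the input letters, g further work symbols.
Sym : ℕ → Set
Sym g = Fin (suc (suc (suc (suc g))))

blank : ∀ {g} → Sym g
blank = Fin.zero
  where import Data.Fin as Fin

symOf : ∀ {g} → Ch → Sym g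
symOf c0  = Fin.suc Fin.zero where import Data.Fin as Fin
symOf c1  = Fin.suc (Fin.suc Fin.zero) where import Data.Fin as Fin
symOf sep = Fin.suc (Fin.suc (Fin.suc Fin.zero)) where import Data.Fin as Fin

data Move : Set where
  left right stay : Move

moveBy : Move → ℤ → ℤ
moveBy left  z = z +ℤ Data.Integer.-[1+ 0 ] where import Data.Integer
moveBy right z = z +ℤ + 1
moveBy stay  z = z

-- A TM with suc q states (start state = zero) and Sym g tape symbols;
-- δ returning nothing means the machine halts.
record TM : Set where
  field
    q g : ℕ
    δ : Fin (suc q) → Sym g → Maybe (Fin (suc q) × Sym g × Move)

module _ (M : TM) where
  open TM M

  record Config : Set where
    constructor conf
    field
      state : Fin (suc q)
      tape  : ℤ → Sym g
      pos   : ℤ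

  write : (ℤ → Sym g) → ℤ → Sym g → ℤ → Sym g
  write τ i s j with j ℤP.≟ i
  ... | yes _ = s
  ... | no  _ = τ j

  step : Config → Config
  step (conf st τ h) with δ st (τ h)
  ... | nothing = conf st τ h
  ... | just (st' , s , mv) = conf st' (write τ h s) (moveBy mv h)

  run : ℕ → Config → Config
  run zero    c = c
  run (suc n) c = run n (step c)

  Halted : Config → Set
  Halted (conf st τ h) = δ st (τ h) ≡ nothing

  initTape : List Ch → ℤ → Sym g
  initTape w (+ i) = lookupOr w i
    where
      lookupOr : List Ch → ℕ → Sym g
      lookupOr []       _       = blank
      lookupOr (c ∷ _)  zero    = symOf c
      lookupOr (_ ∷ cs) (suc i) = lookupOr cs i
  initTape w _ = blank

  initial : List Ch → Config
  initial w = conf Fin.zero (initTape w) (+ 0) where import Data.Fin as Fin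

  OutputIs : Config → List Ch → Set
  OutputIs (conf _ τ h) w = go w h
    where
      go : List Ch → ℤ → Set
      go []       i = τ i ≡ blank
      go (c ∷ cs) i = (τ i ≡ symOf c) × go cs (i +ℤ + 1)

  ComputesWithin : List Ch → List Ch → ℕ → Set
  ComputesWithin w v T =
    Σ ℕ λ s → s ≤ T × Halted (run s (initial w)) × OutputIs (run s (initial w)) v

PolyTimeReduction : Set
PolyTimeReduction =
  Σ TM λ M → Σ ℕ λ c → Σ ℕ λ k →
    ∀ (m : ℕ) (ps : List ℕ) → Σ (List ℕ) λ ps' →
      ComputesWithin M (encMulti m ps) (encSingle ps')
        (c * (2 + length (encMulti m ps)) ^ k)
      × (MultiFeasible m ps → SingleFeasible ps')
      × (SingleFeasible ps' → MultiFeasible m ps)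

-- Time slot t of machine r corresponds to slot r + t * m of a single machine, so
-- multiplying all periods by m reduces m machines to one: a job's residue class
-- modulo m is its machine.  For m = 0 the instance is feasible iff it is empty.
--
-- The Turing machine multiplies serially, in bijective base 2.  Its tape is
--
--   (m_0,y_0) ... (m_{k-1},y_{k-1})  h  used ... used  queue
--
-- where m_i are the digits of m, the y_i are the low digits of a carry C and h is the
-- rest of C.  The queue holds the remaining input, the separator # and the output.
-- In a round the machine looks at the first letter of the queue.  A digit d is
-- removed, C becomes C + d m, the lowest digit of C is appended to the queue and
-- dropped from C.  At sep or #, C is first emptied digit by digit; then sep
-- moves to the end of the queue, and # ends the computation.  Every round lengthens
-- the tape by one cell and appends one output letter, whence the time bound.

module Submission where

open import Defs
open import Algebra.Properties.AbelianGroup using (identityʳ-unique)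
open import Data.Empty using (⊥-elim)
open import Data.Fin using (Fin; zero; suc; toℕ; cast)
open import Data.Fin.Patterns
open import Data.Fin.Properties using (+↔⊎; *↔×; toℕ-injective; toℕ<n; toℕ-fromℕ<; toℕ-cast; toℕ≤pred[n])
open import Data.Integer using (ℤ; +_; -[1+_]) renaming (_+_ to _+ℤ_)
import Data.Integer.Properties as ℤP
open import Data.List using (List; []; _∷_; _++_; _ʳ++_; [_]; length; map; lookup; concatMap; replicate)
open import Data.List.Properties using (++-assoc; ++-identityʳ; length-++; length-map; length-replicate; map-++)
open import Data.List.Relation.Unary.All as All using (All; []; _∷_)
import Data.List.Relation.Unary.All.Properties as AllP
open import Data.Maybe as Maybe using (Maybe; just; nothing)
open import Data.Nat
open import Data.Nat.Binary.Base using (ℕᵇ; 2[1+_]; 1+[2_])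
  renaming (zero to zeroᵇ; fromℕ to toBin; toℕ to fromBin)
open import Data.Nat.Binary.Properties using ()
  renaming (fromℕ-toℕ to toBin-fromBin; toℕ-fromℕ to fromBin-toBin)
open import Data.Nat.DivMod using (_mod_; [m+kn]%n≡m%n; m<n⇒m%n≡m; m≡m%n+[m/n]*n)
open import Data.Nat.Properties
open import Data.Nat.Tactic.RingSolver using (solve-∀)
open import Data.Product using (Σ; ∃; _×_; _,_; proj₁; proj₂)
open import Data.Product.Function.NonDependent.Propositional using (_×-↔_)
open import Data.Sum using (_⊎_; inj₁; inj₂)
open import Data.Sum.Function.Propositional using (_⊎-↔_)
open import Function using (_∘_)
open import Function.Bundles using (_↔_; Inverse)
open import Function.Construct.Composition using (_↔-∘_)
open import Function.Construct.Identity using (↔-id)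
open import Function.Construct.Symmetry using (↔-sym)
open import Relation.Binary.PropositionalEquality hiding ([_])
open import Relation.Nullary using (yes; no)

-- Scaling the periods

cast-injective : ∀ {k n} (eq : k ≡ n) {i j : Fin k} → cast eq i ≡ cast eq j → i ≡ j
cast-injective eq {i} {j} e = toℕ-injective (trans (sym (toℕ-cast eq i)) (trans (cong toℕ e) (toℕ-cast eq j)))

module _ {m : ℕ} .{{_ : NonZero m}} where

  slot : Fin m → ℕ → ℕ
  slot r t = toℕ r + t * m

  -- The remainder modulo `m` recovers the machine, because `toℕ r < m`; then `m` cancels.
  slot-injective : ∀ {r r′ t t′} → slot r t ≡ slot r′ t′ → r ≡ r′ × t ≡ t′
  slot-injective {r} {r′} {t} {t′} eq = r≡r′ , *-cancelʳ-≡ t t′ m (+-cancelˡ-≡ (toℕ r) _ _ (trans eq (cong (λ x → toℕ x + t′ * m) (sym r≡r′))))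
    where
    rem : ∀ r t → slot r t % m ≡ toℕ r
    rem r t = trans ([m+kn]%n≡m%n (toℕ r) t m) (m<n⇒m%n≡m (toℕ<n r))
    r≡r′ = toℕ-injective (trans (sym (rem r t)) (trans (cong (_% m) eq) (rem r′ t′)))

  slot-progression : ∀ r a k p → slot r (a + k * p) ≡ slot r a + k * (m * p)
  slot-progression r a k p = eq (toℕ r) a k p m
    where
    eq : ∀ r a k p m → r + (a + k * p) * m ≡ r + a * m + k * (m * p)
    eq = solve-∀

module _ (m : ℕ) .{{_ : NonZero m}} (ps : List ℕ) where

  scaled : List ℕ
  scaled = map (m *_) ps

  toScaled : Job ps → Job scaled
  toScaled = cast (sym (length-map (m *_) ps))

  fromScaled : Job scaled → Job ps
  fromScaled = cast (length-map (m *_) ps)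

  period-fromScaled : ∀ j → period scaled j ≡ m * period ps (fromScaled j)
  period-fromScaled j = go ps j
    where
    go : ∀ ps (j : Job (map (m *_) ps)) → lookup (map (m *_) ps) j ≡ m * lookup ps (cast (length-map (m *_) ps) j)
    go (p ∷ ps) zero    = refl
    go (p ∷ ps) (suc j) = go ps j

  period-toScaled : ∀ j → period scaled (toScaled j) ≡ m * period ps j
  period-toScaled j = trans (period-fromScaled (toScaled j)) (cong (λ i → m * period ps i)
    (toℕ-injective (trans (toℕ-cast (length-map (m *_) ps) (toScaled j)) (toℕ-cast (sym (length-map (m *_) ps)) j))))

  -- By `slot-injective`, a collision on the single machine comes from a collision on one machine in
  -- one time slot.
  multi⇒single : MultiFeasible m ps → SingleFeasible scaled
  multi⇒single (S , pos , disjoint) = S′ , AllP.map⁺ (All.map (λ p≥1 → *-mono-≤ (>-nonZero⁻¹ m) p≥1) pos) , disjoint′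
    where
    open Schedule S
    S′ : Schedule 1 scaled
    S′ = record { machine = λ _ → zero ; start = λ j → slot (machine (fromScaled j)) (start (fromScaled j)) }
    runs : ∀ j k → Schedule.start S′ j + k * period scaled j ≡
      slot (machine (fromScaled j)) (start (fromScaled j) + k * period ps (fromScaled j))
    runs j k = trans (cong (λ p → Schedule.start S′ j + k * p) (period-fromScaled j))
                     (sym (slot-progression (machine (fromScaled j)) (start (fromScaled j)) k _))
    disjoint′ : ∀ i j t → i ≢ j → _ → ExecutesAt (period scaled i) (Schedule.start S′ i) t →
                ExecutesAt (period scaled j) (Schedule.start S′ j) t → _
    disjoint′ i j t i≢j _ (k , t≡) (l , t≡′)
      with slot-injective (trans (sym (runs i k)) (trans (trans (sym t≡) t≡′) (runs j l)))
    ... | r≡ , s≡ = disjoint (fromScaled i) (fromScaled j) _ (i≢j ∘ cast-injective (length-map (m *_) ps)) r≡ (k , refl) (l , s≡)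

  -- Scaled periods are multiples of `m`, so a job never leaves its residue class modulo `m`, which
  -- serves as its fixed machine.
  single⇒multi : SingleFeasible scaled → MultiFeasible m ps
  single⇒multi (S , pos , disjoint) = S′ , All.map positive (AllP.map⁻ pos) , disjoint′
    where
    open Schedule S
    positive : ∀ {p} → 1 ≤ m * p → 1 ≤ p
    positive {zero}  m*0≥1 = ≤-trans m*0≥1 (≤-reflexive (*-zeroʳ m))
    positive {suc p} _     = s≤s z≤n
    S′ : Schedule m ps
    S′ = record { machine = λ j → start (toScaled j) mod m ; start = λ j → start (toScaled j) / m }
    runs : ∀ j k → slot (start (toScaled j) mod m) (start (toScaled j) / m + k * period ps j) ≡
      start (toScaled j) + k * period scaled (toScaled j)
    runs j k = trans (slot-progression (start (toScaled j) mod m) (start (toScaled j) / m) k (period ps j))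
      (cong₂ (λ a p → a + k * p)
        (trans (cong (_+ start (toScaled j) / m * m) (toℕ-fromℕ< _)) (sym (m≡m%n+[m/n]*n (start (toScaled j)) m)))
        (sym (period-toScaled j)))
    only : (x y : Fin 1) → x ≡ y
    only zero zero = refl
    disjoint′ : ∀ i j t → i ≢ j → Schedule.machine S′ i ≡ Schedule.machine S′ j →
                ExecutesAt (period ps i) (Schedule.start S′ i) t →
                ExecutesAt (period ps j) (Schedule.start S′ j) t → _
    disjoint′ i j t i≢j r≡ (k , t≡) (l , t≡′) =
      disjoint (toScaled i) (toScaled j) (slot (start (toScaled i) mod m) t) (i≢j ∘ cast-injective (sym (length-map (m *_) ps))) (only _ _)
        (k , trans (cong (slot _) t≡) (runs i k))
        (l , trans (cong₂ slot r≡ t≡′) (runs j l))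

-- Tapes and zippers

cellAt : ∀ {A : Set} → A → List A → ℕ → A
cellAt d []       _       = d
cellAt d (x ∷ _)  zero    = x
cellAt d (_ ∷ xs) (suc i) = cellAt d xs i

-- The local functions of OutputIs and initTape cannot be named from outside.  Each is
-- recovered as the solution of a metavariable: abstracting the arguments that the local
-- function inherits from its parent makes the constraint a linear pattern.
mutual
  outputFrom : (M : TM) → Fin (suc (TM.q M)) → (ℤ → Sym (TM.g M)) → ℤ → List Ch → List Ch → ℤ → Set
  outputFrom = _

  outputFrom-unfold : ∀ M st τ h c cs → τ h ≡ symOf c → outputFrom M st τ h (c ∷ cs) cs (h +ℤ + 1) →
    OutputIs M (conf st τ h) (c ∷ cs)
  outputFrom-unfold M st τ h c cs eq p with c ∷ cs | h +ℤ + 1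
  ... | w | j = eq , p

mutual
  inputFrom : (M : TM) → List Ch → ℕ → List Ch → ℕ → Sym (TM.g M)
  inputFrom = _

  inputFrom-unfold : ∀ M c cs i → initTape M (c ∷ cs) (+ suc i) ≡ inputFrom M (c ∷ cs) (suc i) cs i
  inputFrom-unfold M c cs i with c ∷ cs | suc i
  ... | w | j = refl

-- The inclusive bound `i ≤ length w` covers the blank that ends the output. The arguments inherited
-- from `OutputIs`, `h₀` and `w₀`, stay fixed in the induction on `w`.
outputFrom-intro : ∀ M st τ h₀ w₀ w h →
  (∀ i → i ≤ length w → τ (h +ℤ + i) ≡ cellAt blank (map symOf w) i) → outputFrom M st τ h₀ w₀ w h
outputFrom-intro M st τ h₀ w₀ [] h ag = trans (cong τ (sym (ℤP.+-identityʳ h))) (ag 0 z≤n)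
outputFrom-intro M st τ h₀ w₀ (c ∷ w) h ag =
  trans (cong τ (sym (ℤP.+-identityʳ h))) (ag 0 z≤n) ,
  outputFrom-intro M st τ h₀ w₀ w (h +ℤ + 1)
    (λ i i≤ → trans (cong τ (ℤP.+-assoc h (+ 1) (+ i))) (ag (suc i) (s≤s i≤)))

outputIs-intro : ∀ M st τ h w → (∀ i → i ≤ length w → τ (h +ℤ + i) ≡ cellAt blank (map symOf w) i) →
  OutputIs M (conf st τ h) w
outputIs-intro M st τ h []      ag = trans (cong τ (sym (ℤP.+-identityʳ h))) (ag 0 z≤n)
outputIs-intro M st τ h (c ∷ w) ag =
  outputFrom-unfold M st τ h c w (trans (cong τ (sym (ℤP.+-identityʳ h))) (ag 0 z≤n))
    (outputFrom-intro M st τ h (c ∷ w) w (h +ℤ + 1)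
      (λ i i≤ → trans (cong τ (ℤP.+-assoc h (+ 1) (+ i))) (ag (suc i) (s≤s i≤))))

inputFrom-cellAt : ∀ M w₀ i₀ w i → inputFrom M w₀ i₀ w i ≡ cellAt blank (map symOf w) i
inputFrom-cellAt M w₀ i₀ []      i       = refl
inputFrom-cellAt M w₀ i₀ (c ∷ w) zero    = refl
inputFrom-cellAt M w₀ i₀ (c ∷ w) (suc i) = inputFrom-cellAt M w₀ i₀ w i

initTape-cellAt : ∀ M w i → initTape M w (+ i) ≡ cellAt blank (map symOf w) i
initTape-cellAt M []      i       = refl
initTape-cellAt M (c ∷ w) zero    = refl
initTape-cellAt M (c ∷ w) (suc i) = trans (inputFrom-unfold M c w i) (inputFrom-cellAt M (c ∷ w) (suc i) w i)

infixr 1 _⊎-fin_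
infixr 2 _×-fin_

_⊎-fin_ : ∀ {A B : Set} {m n} → A ↔ Fin m → B ↔ Fin n → (A ⊎ B) ↔ Fin (m + n)
f ⊎-fin g = ↔-sym +↔⊎ ↔-∘ (f ⊎-↔ g)

_×-fin_ : ∀ {A B : Set} {m n} → A ↔ Fin m → B ↔ Fin n → (A × B) ↔ Fin (m * n)
f ×-fin g = ↔-sym *↔× ↔-∘ (f ×-↔ g)

-- Both halves of a zipper are padded with infinitely many empty cells; the head is on
-- the first cell of the right half.
module ZipperMachine {Q Γ : Set} (empty : Γ) (δ : Q → Γ → Maybe (Q × Γ × Move)) where

  infix 4 _∣_∣_

  record Zipper : Set where
    constructor _∣_∣_
    field
      state  : Q
      before : List Γ
      after  : List Γ

  headΓ : List Γ → Γ
  headΓ xs = cellAt empty xs 0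

  tailΓ : List Γ → List Γ
  tailΓ []       = []
  tailΓ (_ ∷ xs) = xs

  -- Past the listed cells a padding cell is exposed. Left sweeps also start from this form: the
  -- head is on the last cell of a block, even if the block is empty.
  moveLeft : Q → List Γ → List Γ → Zipper
  moveLeft q []       rs = q ∣ [] ∣ empty ∷ rs
  moveLeft q (x ∷ ls) rs = q ∣ ls ∣ x ∷ rs

  act : Q → Γ → Move → List Γ → List Γ → Zipper
  act q s left  ls rs = moveLeft q ls (s ∷ rs)
  act q s right ls rs = q ∣ s ∷ ls ∣ rs
  act q s stay  ls rs = q ∣ ls ∣ s ∷ rs

  cellAt-tail : ∀ xs i → cellAt empty xs (suc i) ≡ cellAt empty (tailΓ xs) i
  cellAt-tail []       i = refl
  cellAt-tail (_ ∷ xs) i = refl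

  data Steps : ℕ → Zipper → Zipper → Set where
    finish : ∀ {z} → Steps 0 z z
    advance : ∀ {n q ls rs q′ s mv z} → δ q (headΓ rs) ≡ just (q′ , s , mv) →
            Steps n (act q′ s mv ls (tailΓ rs)) z → Steps (suc n) (q ∣ ls ∣ rs) z

  infixr 5 _⨾_
  _⨾_ : ∀ {m n x y z} → Steps m x y → Steps n y z → Steps (m + n) x z
  finish       ⨾ t = t
  advance eq s ⨾ t = advance eq (s ⨾ t)

  -- Left sweeps are analysed by induction from the far end, so that the last step is
  -- the one split off.
  snoc : ∀ {n z q ls rs q′ s mv} → Steps n z (q ∣ ls ∣ rs) → δ q (headΓ rs) ≡ just (q′ , s , mv) →
    Steps (suc n) z (act q′ s mv ls (tailΓ rs))
  snoc finish         eq′ = advance eq′ finish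
  snoc (advance eq s) eq′ = advance eq (snoc s eq′)

  recount : ∀ {m n x y} → m ≡ n → Steps m x y → Steps n x y
  recount refl s = s

  retarget : ∀ {n x y z} → y ≡ z → Steps n x y → Steps n x z
  retarget refl s = s

  reload : ∀ {n q ls ls′ rs z} → ls ≡ ls′ → Steps n (q ∣ ls ∣ rs) z → Steps n (q ∣ ls′ ∣ rs) z
  reload refl s = s

  Passes : Q → Move → Γ → Set
  Passes q mv s = δ q s ≡ just (q , s , mv)

  passRight : ∀ {q ls xs rs} → All (Passes q right) xs → Steps (length xs) (q ∣ ls ∣ xs ++ rs) (q ∣ xs ʳ++ ls ∣ rs)
  passRight []       = finish
  passRight (p ∷ ps) = advance p (passRight ps)

  -- For `x ∷ xs`, reversed append pushes `x` onto `ls` by computation, so the induction hypothesis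
  -- ends with the head on `x` and one step remains.
  passLeft : ∀ {q ls xs rs} → All (Passes q left) xs →
    Steps (length xs) (moveLeft q (xs ʳ++ ls) rs) (moveLeft q ls (xs ++ rs))
  passLeft []       = finish
  passLeft (p ∷ ps) = snoc (passLeft ps) p

-- Simulation of zipper machines by Turing machines

module Simulation {Q Γ : Set} {k g : ℕ} (Q-fin : Q ↔ Fin (suc k)) (Γ-fin : Γ ↔ Sym g)
  (empty : Γ) (δ : Q → Γ → Maybe (Q × Γ × Move)) where

  open ZipperMachine empty δ

  encQ : Q → Fin (suc k)
  encQ = Inverse.to Q-fin

  decQ : Fin (suc k) → Q
  decQ = Inverse.from Q-fin

  encΓ : Γ → Sym g
  encΓ = Inverse.to Γ-fin

  decΓ : Sym g → Γ
  decΓ = Inverse.from Γ-fin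

  encodeAction : Q × Γ × Move → Fin (suc k) × Sym g × Move
  encodeAction (q , s , mv) = encQ q , encΓ s , mv

  M : TM
  M = record { q = k ; g = g ; δ = λ q s → Maybe.map encodeAction (δ (decQ q) (decΓ s)) }

  -- Cells are addressed relative to the head, so that a move merely reassociates offsets.
  record Represents (c : Config M) (z : Zipper) : Set where
    open Config c
    open Zipper z renaming (state to q)
    field
      state≡  : state ≡ encQ q
      after≡  : ∀ i → tape (pos +ℤ + i) ≡ encΓ (cellAt empty after i)
      before≡ : ∀ i → tape (pos +ℤ -[1+ i ]) ≡ encΓ (cellAt empty before i)

  write-here : ∀ τ h s → write M τ h s h ≡ s
  write-here τ h s with h ℤP.≟ h
  ... | yes _ = refl
  ... | no h≢h = ⊥-elim (h≢h refl)

  write-away : ∀ τ h s d → d ≢ + 0 → write M τ h s (h +ℤ d) ≡ τ (h +ℤ d)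
  write-away τ h s d d≢0 with (h +ℤ d) ℤP.≟ h
  ... | no _  = refl
  ... | yes p = ⊥-elim (d≢0 (identityʳ-unique ℤP.+-0-abelianGroup h d p))

  Represents-act : ∀ {st τ h q ls rs} q′ s mv → Represents (conf st τ h) (q ∣ ls ∣ rs) →
    Represents (conf (encQ q′) (write M τ h (encΓ s)) (moveBy mv h)) (act q′ s mv ls (tailΓ rs))
  Represents-act {st} {τ} {h} {q} {ls} {rs} q′ s mv r = go mv
    where
    open Represents r
    τ′ = write M τ h (encΓ s)
    here : τ′ (h +ℤ + 0) ≡ encΓ s
    here = trans (cong τ′ (ℤP.+-identityʳ h)) (write-here τ h (encΓ s))
    fwd : ∀ i → τ′ (h +ℤ + suc i) ≡ encΓ (cellAt empty (tailΓ rs) i)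
    fwd i = trans (write-away τ h _ (+ suc i) (λ ())) (trans (after≡ (suc i)) (cong encΓ (cellAt-tail rs i)))
    bwd : ∀ i → τ′ (h +ℤ -[1+ i ]) ≡ encΓ (cellAt empty ls i)
    bwd i = trans (write-away τ h _ -[1+ i ] (λ ())) (before≡ i)
    move : ∀ a b {x} → τ′ (h +ℤ (a +ℤ b)) ≡ x → τ′ ((h +ℤ a) +ℤ b) ≡ x
    move a b = trans (cong τ′ (ℤP.+-assoc h a b))
    bwd-left : ∀ ls → (∀ i → τ′ (h +ℤ -[1+ i ]) ≡ encΓ (cellAt empty ls i)) →
      Represents (conf (encQ q′) τ′ (h +ℤ -[1+ 0 ])) (moveLeft q′ ls (s ∷ tailΓ rs))
    bwd-left [] b = record
      { state≡ = refl
      ; after≡ = λ { 0 → move -[1+ 0 ] (+ 0) (b 0) ; 1 → move -[1+ 0 ] (+ 1) here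
                   ; (suc (suc i)) → move -[1+ 0 ] (+ suc (suc i)) (fwd i) }
      ; before≡ = λ i → move -[1+ 0 ] -[1+ i ] (b (suc i)) }
    bwd-left (x ∷ ls) b = record
      { state≡ = refl
      ; after≡ = λ { 0 → move -[1+ 0 ] (+ 0) (b 0) ; 1 → move -[1+ 0 ] (+ 1) here
                   ; (suc (suc i)) → move -[1+ 0 ] (+ suc (suc i)) (fwd i) }
      ; before≡ = λ i → move -[1+ 0 ] -[1+ i ] (b (suc i)) }
    go : ∀ mv → Represents (conf (encQ q′) τ′ (moveBy mv h)) (act q′ s mv ls (tailΓ rs))
    go left  = bwd-left ls bwd
    go right = record
      { state≡ = refl
      ; after≡ = λ i → move (+ 1) (+ i) (fwd i)
      ; before≡ = λ { 0 → move (+ 1) -[1+ 0 ] here ; (suc i) → move (+ 1) -[1+ suc i ] (bwd i) } }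
    go stay  = record
      { state≡ = refl
      ; after≡ = λ { 0 → here ; (suc i) → fwd i }
      ; before≡ = bwd }

  TM-δ : ∀ {st τ h q ls rs} → Represents (conf st τ h) (q ∣ ls ∣ rs) →
    TM.δ M st (τ h) ≡ Maybe.map encodeAction (δ q (headΓ rs))
  TM-δ {τ = τ} {h} {q} {rs = rs} r = cong₂ (λ a b → Maybe.map encodeAction (δ a b))
    (trans (cong decQ state≡) (Inverse.strictlyInverseʳ Q-fin q))
    (trans (cong decΓ (trans (cong τ (sym (ℤP.+-identityʳ h))) (after≡ 0))) (Inverse.strictlyInverseʳ Γ-fin (headΓ rs)))
    where open Represents r

  step-Represents : ∀ {c q ls rs q′ s mv} → δ q (headΓ rs) ≡ just (q′ , s , mv) →
    Represents c (q ∣ ls ∣ rs) → Represents (step M c) (act q′ s mv ls (tailΓ rs))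
  step-Represents {conf st τ h} {q} {ls} {rs} {q′} {s} {mv} eq r
    with TM.δ M st (τ h) | trans (TM-δ r) (cong (Maybe.map encodeAction) eq)
  ... | .(just _) | refl = Represents-act q′ s mv r

  run-Represents : ∀ {n c z z′} → Steps n z z′ → Represents c z → Represents (run M n c) z′
  run-Represents finish          r = r
  run-Represents (advance eq ss) r = run-Represents ss (step-Represents eq r)

-- The multiplication machine

-- Last digit (1 or 2, and 0 only for the number 0) and the number without it.
dig : ℕ → Fin 3
dig 0 = 0F
dig 1 = 1F
dig 2 = 2F
dig (suc (suc n@(suc _))) = dig n

half : ℕ → ℕ
half 0 = 0
half 1 = 0
half 2 = 0
half (suc (suc n@(suc _))) = suc (half n)

-- Truncation lets the transitions be specified by arithmetic on `ℕ`; the bounds proved later show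
-- that nothing is lost.
clamp : ∀ k → ℕ → Fin (suc k)
clamp zero    _       = 0F
clamp (suc k) zero    = 0F
clamp (suc k) (suc n) = suc (clamp k n)

Letter : Set
Letter = Fin 4

pattern ℓ1   = 0F
pattern ℓ2   = 1F
pattern ℓsep = 2F
pattern ℓ#   = 3F

multiplier : Letter → ℕ
multiplier ℓ1 = 1
multiplier ℓ2 = 2
multiplier _  = 0

digitLetter : Fin 2 → Letter
digitLetter 0F = ℓ1
digitLetter 1F = ℓ2

-- The value at 0F is never used.
letterOf : Fin 3 → Letter
letterOf 0F      = ℓ#
letterOf (suc b) = digitLetter b

-- The sizes 5 and 8 below suffice: C ≤ 2 m + 3 between rounds and C ≤ 4 m + 7
-- during one, so that h ≤ 7, and the carry of a column is at most 4.
Γ : Set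
Γ = Fin 1 ⊎ Letter ⊎ Fin 1 ⊎ (Fin 2 × Fin 3) ⊎ Fin 8

pattern empty      = inj₁ 0F
pattern letter ℓ   = inj₂ (inj₁ ℓ)
pattern used       = inj₂ (inj₂ (inj₁ 0F))
pattern cell b y   = inj₂ (inj₂ (inj₂ (inj₁ (b , y))))
pattern overflow h = inj₂ (inj₂ (inj₂ (inj₂ h)))

Γ-fin : Γ ↔ Fin 20
Γ-fin = ↔-id _ ⊎-fin ↔-id _ ⊎-fin ↔-id _ ⊎-fin (↔-id _ ×-fin ↔-id _) ⊎-fin ↔-id _

-- consume: remove the first queue letter, then append ℓ.  append: append ℓ.
-- return: sweep left, with ℓ the last queue letter passed.  shift: move the digits of C
-- down by one place.  dispatch: act on the queue head ℓ, at the leftmost cell.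
-- add: add m times the digit ℓ with carry c; the digit e is to be appended.
Q : Set
Q = Fin 6 ⊎ Letter ⊎ Letter ⊎ Letter ⊎ Letter ⊎ (Letter × Fin 3) ⊎ (Letter × Letter × Fin 5)

pattern start        = inj₁ 0F
pattern wipe         = inj₁ 1F
pattern load         = inj₁ 2F
pattern mark         = inj₁ 3F
pattern seek         = inj₁ 4F
pattern done         = inj₁ 5F
pattern consume ℓ    = inj₂ (inj₁ ℓ)
pattern append ℓ     = inj₂ (inj₂ (inj₁ ℓ))
pattern return ℓ     = inj₂ (inj₂ (inj₂ (inj₁ ℓ)))
pattern dispatch ℓ   = inj₂ (inj₂ (inj₂ (inj₂ (inj₁ ℓ))))
pattern shift ℓ y    = inj₂ (inj₂ (inj₂ (inj₂ (inj₂ (inj₁ (ℓ , y))))))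
pattern add ℓ e c    = inj₂ (inj₂ (inj₂ (inj₂ (inj₂ (inj₂ (ℓ , e , c))))))

Q-fin : Q ↔ Fin 114
Q-fin = ↔-id _ ⊎-fin ↔-id _ ⊎-fin ↔-id _ ⊎-fin ↔-id _ ⊎-fin ↔-id _
      ⊎-fin (↔-id _ ×-fin ↔-id _) ⊎-fin (↔-id _ ×-fin ↔-id _ ×-fin ↔-id _)

-- One column of the long addition C + d m: a digit of C, d times a digit of m, and the incoming
-- carry.
columnSum : Letter → Fin 2 → Fin 3 → ℕ → ℕ
columnSum ℓ b y c = toℕ y + multiplier ℓ * suc (toℕ b) + c

addAction : Letter → Letter → Fin 2 → Fin 3 → ℕ → Q × Γ × Move
addAction ℓ e b y c = let s = columnSum ℓ b y c in add ℓ e (clamp 4 (half s)) , cell b (dig s) , right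

δ : Q → Γ → Maybe (Q × Γ × Move)
δ start (letter ℓ1)                  = just (load , cell 0F 0F , right)
δ start (letter ℓ2)                  = just (load , cell 1F 0F , right)
-- Here m = 0 and there is a job. A blank written after this separator leaves the output `[ sep ]`,
-- which encodes the infeasible instance `[ 0 ]`.
δ start (letter ℓsep)                = just (wipe , letter ℓsep , right)
δ wipe _                             = just (done , empty , left)
δ load (letter ℓ1)                   = just (load , cell 0F 0F , right)
δ load (letter ℓ2)                   = just (load , cell 1F 0F , right)
δ load (letter ℓsep)                 = just (mark , overflow 0F , right)
δ mark (letter ℓ)                    = just (mark , letter ℓ , right)
-- The first separator was overwritten by the overflow cell; it is restored as the first output
-- letter, behind #.
δ mark empty                         = just (append ℓsep , letter ℓ# , right)
δ (consume e) (letter _)             = just (append e , used , right)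
δ (consume e) s                      = just (consume e , s , right)
δ (append e) empty                   = just (return e , letter e , left)
δ (append e) s                       = just (append e , s , right)
δ (return _) (letter ℓ)              = just (return ℓ , letter ℓ , left)
δ (return ℓ) used                    = just (return ℓ , used , left)
δ (return ℓ) (overflow h)            = just (shift ℓ (dig (toℕ h)) , overflow (clamp 7 (half (toℕ h))) , left)
δ (shift ℓ y) (cell b y′)            = just (shift ℓ y′ , cell b y , left)
-- The digit that drops out is the lowest one of C, which has already been appended to the queue.
δ (shift ℓ _) empty                  = just (dispatch ℓ , empty , right)
-- In bijective base 2 only the number 0 has lowest digit `0F`, so the first cell alone tells
-- whether C is empty.
δ (dispatch ℓsep) (cell b 0F)        = just (consume ℓsep , cell b 0F , right)
δ (dispatch ℓsep) (cell b y@(suc _)) = just (append (letterOf y) , cell b y , right)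
δ (dispatch ℓ#) (cell b 0F)          = just (seek , cell b 0F , right)
δ (dispatch ℓ#) (cell b y@(suc _))   = just (append (letterOf y) , cell b y , right)
-- The first column fixes the lowest digit of the new C, so the state can carry it to the end of the
-- queue in the same sweep.
δ (dispatch ℓ) (cell b y)            = just (addAction ℓ (letterOf (dig (columnSum ℓ b y 0))) b y 0)
δ (add ℓ e c) (cell b y)             = just (addAction ℓ e b y (toℕ c))
δ (add ℓ e c) (overflow h)           = just (consume e , overflow (clamp 7 (toℕ h + toℕ c)) , right)
δ seek (letter ℓ#)                   = just (done , letter ℓ# , right)
δ seek s                             = just (seek , s , right)
δ _ _                                = nothing

open ZipperMachine empty δ
open Simulation Q-fin Γ-fin empty δ

-- Arithmetic in bijective base 2

digitValue : Fin 2 → ℕ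
digitValue b = suc (toℕ b)

value : List (Fin 2) → ℕ
value []       = 0
value (b ∷ bs) = digitValue b + 2 * value bs

dig-cons : ∀ b n → dig (digitValue b + 2 * n) ≡ suc b
dig-cons b n = trans (cong (λ x → dig (digitValue b + x)) (*-comm 2 n)) (go b n)
  where
  go : ∀ b n → dig (digitValue b + n * 2) ≡ suc b
  go 0F zero    = refl
  go 1F zero    = refl
  go 0F (suc n) = go 0F n
  go 1F (suc n) = go 1F n

half-cons : ∀ b n → half (digitValue b + 2 * n) ≡ n
half-cons b n = trans (cong (λ x → half (digitValue b + x)) (*-comm 2 n)) (go b n)
  where
  go : ∀ b n → half (digitValue b + n * 2) ≡ n
  go 0F zero    = refl
  go 1F zero    = refl
  go 0F (suc n) = cong suc (go 0F n)
  go 1F (suc n) = cong suc (go 1F n)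

data Split : ℕ → Set where
  zero : Split 0
  cons : ∀ b n → Split (digitValue b + 2 * n)

split : ∀ n → Split n
split 0 = zero
split 1 = cons 0F 0
split 2 = cons 1F 0
split (suc (suc n@(suc _))) with split n
... | cons b k = subst Split (lemma (toℕ b) k) (cons b (suc k))
  where
  lemma : ∀ b k → suc b + 2 * suc k ≡ suc (suc (suc b + 2 * k))
  lemma = solve-∀

dig+2*half : ∀ n → toℕ (dig n) + 2 * half n ≡ n
dig+2*half n with split n
... | zero     = refl
... | cons b k rewrite dig-cons b k | half-cons b k = refl

-- A positive number is at least one more than twice its half.
half-≤ : ∀ n j → n ≤ 2 + 2 * j → half n ≤ j
half-≤ n j le with split n
... | zero     = z≤n
... | cons b k rewrite half-cons b k =
  ≤-pred (*-cancelˡ-< 2 k (suc j) (≤-trans (s≤s (m≤n+m (2 * k) (toℕ b))) (≤-trans le (≤-reflexive (sym (*-suc 2 j))))))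

-- Positivity of `a` matters: 0 has last digit `0F`, whereas a positive even number ends in 2.
module _ (a k : ℕ) (a≥1 : 1 ≤ a) where
  private
    assoc-lemma : ∀ d n k → d + 2 * n + 2 * k ≡ d + 2 * (n + k)
    assoc-lemma = solve-∀

    shape : ∀ {a′} → Split a′ → a′ ≡ a → dig (a′ + 2 * k) ≡ dig a′ × half (a′ + 2 * k) ≡ half a′ + k
    shape zero       refl = ⊥-elim (1+n≰n a≥1)
    shape (cons b n) _
      rewrite assoc-lemma (digitValue b) n k | dig-cons b n | half-cons b n = dig-cons b (n + k) , half-cons b (n + k)

  dig-+2* : dig (a + 2 * k) ≡ dig a
  dig-+2* = proj₁ (shape (split a) refl)

  half-+2* : half (a + 2 * k) ≡ half a + k
  half-+2* = proj₂ (shape (split a) refl)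

toℕ-clamp : ∀ k {n} → n ≤ k → toℕ (clamp k n) ≡ n
toℕ-clamp zero    z≤n       = refl
toℕ-clamp (suc k) z≤n       = refl
toℕ-clamp (suc k) (s≤s n≤k) = cong suc (toℕ-clamp k n≤k)

multiplier≤2 : ∀ ℓ → multiplier ℓ ≤ 2
multiplier≤2 ℓ1   = s≤s z≤n
multiplier≤2 ℓ2   = s≤s (s≤s z≤n)
multiplier≤2 ℓsep = z≤n
multiplier≤2 ℓ#   = z≤n

column : Letter → Fin 2 → ℕ → ℕ → ℕ
column ℓ b n c = columnSum ℓ b (dig n) c

-- The total is the column sum plus an even number. As the multiplier and the digit of m are
-- positive, so is the column sum, and `dig-+2*` and `half-+2*` apply.
module Column (ℓ : Letter) (pos : 1 ≤ multiplier ℓ) (b : Fin 2) (n k c : ℕ) where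
  total : ℕ
  total = n + multiplier ℓ * (digitValue b + 2 * k) + c

  private
    rest : ℕ
    rest = half n + multiplier ℓ * k

    shape : ∀ y h d w k c → (y + 2 * h) + d * (w + 2 * k) + c ≡ (y + d * w + c) + 2 * (h + d * k)
    shape = solve-∀

    total≡ : total ≡ column ℓ b n c + 2 * rest
    total≡ = trans (cong (λ x → x + multiplier ℓ * (digitValue b + 2 * k) + c) (sym (dig+2*half n)))
                   (shape (toℕ (dig n)) (half n) (multiplier ℓ) (digitValue b) k c)

    column≥1 : 1 ≤ column ℓ b n c
    column≥1 = ≤-trans (*-mono-≤ pos (s≤s {n = toℕ b} z≤n))
                 (≤-trans (m≤n+m _ (toℕ (dig n))) (m≤m+n _ c))

  dig-total : dig total ≡ dig (column ℓ b n c)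
  dig-total = trans (cong dig total≡) (dig-+2* _ rest column≥1)

  half-total : half total ≡ half n + multiplier ℓ * k + half (column ℓ b n c)
  half-total = trans (trans (cong half total≡) (half-+2* _ rest column≥1)) (+-comm (half (column ℓ b n c)) rest)

  carry-≤ : c ≤ 4 → half (column ℓ b n c) ≤ 4
  -- The column sum is at most 2 + 2 * 2 + 4 = 2 + 2 * 4.
  carry-≤ c≤4 = half-≤ _ 4
    (+-mono-≤ (+-mono-≤ (toℕ≤pred[n] (dig n)) (*-mono-≤ (multiplier≤2 ℓ) (s≤s (toℕ≤pred[n] b)))) c≤4)

digitValue≤2 : ∀ b → digitValue b ≤ 2
digitValue≤2 b = s≤s (toℕ≤pred[n] b)

-- The bound on C in terms of m passes to both halves, hence from register to register; at the
-- overflow cell, where m is used up, it reads 3. Likewise `half-large` leads to 7.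
half-small : ∀ b v {n} → n ≤ 2 * (digitValue b + 2 * v) + 3 → half n ≤ 2 * v + 3
half-small b v {n} le = half-≤ n (2 * v + 3) (begin
  n                              ≤⟨ le ⟩
  2 * (digitValue b + 2 * v) + 3 ≤⟨ +-monoˡ-≤ 3 (*-monoʳ-≤ 2 (+-monoˡ-≤ (2 * v) (digitValue≤2 b))) ⟩
  2 * (2 + 2 * v) + 3            ≤⟨ n≤1+n _ ⟩
  suc (2 * (2 + 2 * v) + 3)      ≡⟨ eq v ⟩
  2 + 2 * (2 * v + 3)            ∎)
  where
  open ≤-Reasoning
  eq : ∀ v → suc (2 * (2 + 2 * v) + 3) ≡ 2 + 2 * (2 * v + 3)
  eq = solve-∀

half-large : ∀ b v {n} → n ≤ 4 * (digitValue b + 2 * v) + 7 → half n ≤ 4 * v + 7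
half-large b v {n} le = half-≤ n (4 * v + 7) (begin
  n                              ≤⟨ le ⟩
  4 * (digitValue b + 2 * v) + 7 ≤⟨ +-monoˡ-≤ 7 (*-monoʳ-≤ 4 (+-monoˡ-≤ (2 * v) (digitValue≤2 b))) ⟩
  4 * (2 + 2 * v) + 7            ≤⟨ n≤1+n _ ⟩
  suc (4 * (2 + 2 * v) + 7)      ≡⟨ eq v ⟩
  2 + 2 * (4 * v + 7)            ∎)
  where
  open ≤-Reasoning
  eq : ∀ v → suc (4 * (2 + 2 * v) + 7) ≡ 2 + 2 * (4 * v + 7)
  eq = solve-∀

-- Sweeps and rounds

letters : List Letter → List Γ
letters = map (λ ℓ → letter ℓ)

firstOr : Letter → List Letter → Letter
firstOr d []      = d
firstOr d (ℓ ∷ _) = ℓ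

-- Unlike in `passLeft` the state changes: it remembers the last letter passed, in the end the head
-- of the queue.
returnLetters : ∀ {e ls rs} W → Steps (length W) (moveLeft (return e) (letters W ʳ++ ls) rs)
                                                 (moveLeft (return (firstOr e W)) ls (letters W ++ rs))
returnLetters []      = finish
returnLetters (ℓ ∷ W) = snoc (returnLetters W) refl

-- The cells (m_i , y_i) and h, for the digits of m and the number n = C.
registers : List (Fin 2) → ℕ → List Γ
registers []       n = [ overflow (clamp 7 n) ]
registers (b ∷ bs) n = cell b (dig n) ∷ registers bs (half n)

length-registers : ∀ bs n → length (registers bs n) ≡ suc (length bs)
length-registers []       n = refl
length-registers (b ∷ bs) n = cong suc (length-registers bs (half n))

All-registers : ∀ {P : Γ → Set} → (∀ b y → P (cell b y)) → (∀ h → P (overflow h)) → ∀ bs n → All P (registers bs n)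
All-registers c o []       n = o _ ∷ []
All-registers c o (b ∷ bs) n = c b _ ∷ All-registers c o bs (half n)

-- Induction over the columns: by `Column`, the rest of the sweep computes exactly half of the
-- total. The last carry joins the overflow cell.
addSweep : ∀ ℓ e → 1 ≤ multiplier ℓ → ∀ bs {n c ls rs} → n ≤ 2 * value bs + 3 → c ≤ 4 →
  Steps (suc (length bs)) (add ℓ e (clamp 4 c) ∣ ls ∣ registers bs n ++ rs)
                          (consume e ∣ registers bs (n + multiplier ℓ * value bs + c) ʳ++ ls ∣ rs)
addSweep ℓ e pos [] {n} {c} {ls} {rs} n≤ c≤4 = retarget
  (cong (λ h → consume e ∣ overflow (clamp 7 h) ∷ ls ∣ rs) (trans
    (cong₂ _+_ (toℕ-clamp 7 (≤-trans n≤ (m≤m+n 3 4))) (toℕ-clamp 4 c≤4))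
    (cong (_+ c) (sym (trans (cong (_+_ n) (*-zeroʳ (multiplier ℓ))) (+-identityʳ n))))))
  (advance refl finish)
addSweep ℓ e pos (b ∷ bs) {n} {c} {ls} {rs} n≤ c≤4 = retarget
  (cong₂ (λ d h → consume e ∣ registers bs h ʳ++ cell b d ∷ ls ∣ rs)
    (sym (Column.dig-total ℓ pos b n (value bs) c)) (sym (Column.half-total ℓ pos b n (value bs) c)))
  (advance (cong (λ x → just (addAction ℓ e b (dig n) x)) (toℕ-clamp 4 c≤4))
        (addSweep ℓ e pos bs (half-small b (value bs) n≤) (Column.carry-≤ ℓ pos b n (value bs) c c≤4)))

-- Each cell receives the digit of its right neighbour, which turns the registers of `n` into those
-- of `half n`.
shiftSweep : ∀ {ℓ} bs {n ls rs} → n ≤ 4 * value bs + 7 →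
  Steps (suc (length bs)) (moveLeft (return ℓ) (registers bs n ʳ++ ls) rs)
                          (moveLeft (shift ℓ (dig n)) ls (registers bs (half n) ++ rs))
shiftSweep {ℓ} [] {n} {ls} {rs} n≤ = advance
  (cong (λ h → just (shift ℓ (dig h) , overflow (clamp 7 (half h)) , left)) (toℕ-clamp 7 n≤)) finish
shiftSweep (b ∷ bs) n≤ = snoc (shiftSweep bs (half-large b (value bs) n≤)) refl

-- The common end of all rounds, from the empty cell behind the queue back to the leftmost register.
rewind : ∀ {e} bs n W {v} → v ≤ 4 * value bs + 7 →
  Steps (length W + (n + (length bs + 3)))
    (append e ∣ letters W ʳ++ replicate n used ʳ++ registers bs v ʳ++ [ empty ] ∣ [])
    (dispatch (firstOr e W) ∣ [ empty ] ∣ registers bs (half v) ++ replicate n used ++ letters (W ++ [ e ]))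
rewind {e} bs n W {v} v≤ = recount (count (length W) n (length bs)) (retarget
   (cong (λ xs → dispatch (firstOr e W) ∣ [ empty ] ∣ registers bs (half v) ++ replicate n used ++ xs)
         (sym (map-++ (λ ℓ → letter ℓ) W [ e ])))
   (advance refl (returnLetters W ⨾
     recount (length-replicate n) (passLeft {xs = replicate n used} (AllP.replicate⁺ n refl)) ⨾
     snoc (shiftSweep bs v≤) refl)))
  where
  count : ∀ w n b → suc (w + (n + suc (suc b))) ≡ w + (n + (b + 3))
  count = solve-∀

-- The configuration at the beginning of a round.
record Stage : Set where
  constructor stage
  field
    carry    : ℕ
    consumed : ℕ
    queue    : List Letter

zipper : List (Fin 2) → Stage → Zipper
zipper bs (stage c n W) = dispatch (firstOr ℓ# W) ∣ [ empty ] ∣ registers bs c ++ replicate n used ++ letters W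

firstOr-snoc : ∀ d e W → firstOr e W ≡ firstOr d (W ++ [ e ])
firstOr-snoc d e []      = refl
firstOr-snoc d e (_ ∷ _) = refl

replicate-ʳ++ : ∀ {A : Set} n (x : A) xs → replicate n x ʳ++ (x ∷ xs) ≡ x ∷ (replicate n x ʳ++ xs)
replicate-ʳ++ zero    x xs = refl
replicate-ʳ++ (suc n) x xs = replicate-ʳ++ n x (x ∷ xs)

skipUsed : ∀ {q ls rs} n → Passes q right used →
  Steps n (q ∣ ls ∣ replicate n used ++ rs) (q ∣ replicate n used ʳ++ ls ∣ rs)
skipUsed n p = recount (length-replicate n) (passRight (AllP.replicate⁺ n p))

skipLetters : ∀ {e ls} W → Steps (length W) (append e ∣ ls ∣ letters W) (append e ∣ letters W ʳ++ ls ∣ [])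
skipLetters []      = finish
skipLetters (ℓ ∷ W) = advance refl (skipLetters W)

appendRound : ∀ {e} bs {n W v} → v ≤ 4 * value bs + 7 →
  Steps (length W + (length W + (n + (length bs + 3))))
    (append e ∣ replicate n used ʳ++ registers bs v ʳ++ [ empty ] ∣ letters W)
    (zipper bs (stage (half v) n (W ++ [ e ])))
appendRound {e} bs {n} {W} {v} v≤ = skipLetters W ⨾
  retarget (cong (λ ℓ → dispatch ℓ ∣ [ empty ] ∣ registers bs (half v) ++ replicate n used ++ letters (W ++ [ e ]))
                 (firstOr-snoc ℓ# e W)) (rewind bs n W v≤)

consumeRound : ∀ {e ℓ} bs {n W v} → v ≤ 4 * value bs + 7 →
  Steps (n + suc (length W + (length W + (suc n + (length bs + 3)))))
    (consume e ∣ registers bs v ʳ++ [ empty ] ∣ replicate n used ++ letters (ℓ ∷ W))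
    (zipper bs (stage (half v) (suc n) (W ++ [ e ])))
consumeRound {e} {ℓ} bs {n} {W} {v} v≤ = skipUsed n refl ⨾
  advance refl (reload (replicate-ʳ++ n used (registers bs v ʳ++ [ empty ])) (appendRound bs {suc n} {W} v≤))

size : List (Fin 2) → Stage → ℕ
size bs (stage _ n W) = length bs + (n + length W)

-- Both sweeps cross `z + 1` cells, the overflow cell not being counted in `size`, and each turn at
-- an end costs one step.
roundCost : ℕ → ℕ
roundCost z = 2 * z + 4

markQueue : ∀ W {ls} → Steps (length W + 1) (mark ∣ ls ∣ letters W) (append ℓsep ∣ letters (W ++ [ ℓ# ]) ʳ++ ls ∣ [])
markQueue []      = advance refl finish
markQueue (ℓ ∷ W) = advance refl (markQueue W)

loadRegisters : ∀ bs {ls rs} → Steps (suc (length bs))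
  (load ∣ ls ∣ letters (map digitLetter bs ++ ℓsep ∷ rs)) (mark ∣ registers bs 0 ʳ++ ls ∣ letters rs)
loadRegisters []        = advance refl finish
loadRegisters (0F ∷ bs) = advance refl (loadRegisters bs)
loadRegisters (1F ∷ bs) = advance refl (loadRegisters bs)

loadAll : ∀ bs {ls} → ∃ λ ls′ → Steps (length bs) (load ∣ ls ∣ letters (map digitLetter bs)) (load ∣ ls′ ∣ [])
loadAll []        = _ , finish
loadAll (0F ∷ bs) = _ , advance refl (proj₂ (loadAll bs))
loadAll (1F ∷ bs) = _ , advance refl (proj₂ (loadAll bs))

-- Without jobs the machine stops in state `load` on the blank behind m, and that blank is the
-- encoding of the empty list.
run-empty : ∀ b₀ bs₀ → let bs = b₀ ∷ bs₀ in
  ∃ λ ls → Steps (length bs) (start ∣ [ empty ] ∣ letters (map digitLetter bs)) (load ∣ ls ∣ [])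
run-empty 0F bs₀ = _ , advance refl (proj₂ (loadAll bs₀))
run-empty 1F bs₀ = _ , advance refl (proj₂ (loadAll bs₀))

-- Numerals as lists of digits and letters

bits : ℕᵇ → List (Fin 2)
bits zeroᵇ    = []
bits 1+[2 x ] = 0F ∷ bits x
bits 2[1+ x ] = 1F ∷ bits x

value-bits : ∀ x → value (bits x) ≡ fromBin x
value-bits zeroᵇ    = refl
value-bits 1+[2 x ] = cong (λ n → suc (2 * n)) (value-bits x)
value-bits 2[1+ x ] = trans (cong (λ n → 2 + 2 * n) (value-bits x)) (sym (*-suc 2 (fromBin x)))

unbits : List (Fin 2) → ℕᵇ
unbits []        = zeroᵇ
unbits (0F ∷ ds) = 1+[2 unbits ds ]
unbits (1F ∷ ds) = 2[1+ unbits ds ]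

bits-unbits : ∀ ds → bits (unbits ds) ≡ ds
bits-unbits []        = refl
bits-unbits (0F ∷ ds) = cong (0F ∷_) (bits-unbits ds)
bits-unbits (1F ∷ ds) = cong (1F ∷_) (bits-unbits ds)

numeral : ℕ → List (Fin 2)
numeral n = bits (toBin n)

value-numeral : ∀ n → value (numeral n) ≡ n
value-numeral n = trans (value-bits (toBin n)) (fromBin-toBin n)

-- Bijective numeration has no leading zeros: every digit list is the numeral of its value.
numeral-value : ∀ ds → numeral (value ds) ≡ ds
numeral-value ds = begin
  bits (toBin (value ds))                 ≡⟨ cong (λ xs → bits (toBin (value xs))) (sym (bits-unbits ds)) ⟩
  bits (toBin (value (bits (unbits ds)))) ≡⟨ cong (λ n → bits (toBin n)) (value-bits (unbits ds)) ⟩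
  bits (toBin (fromBin (unbits ds)))      ≡⟨ cong bits (toBin-fromBin (unbits ds)) ⟩
  bits (unbits ds)                        ≡⟨ bits-unbits ds ⟩
  ds                                      ∎
  where open ≡-Reasoning

numeral-cons : ∀ b n → numeral (digitValue b + 2 * n) ≡ b ∷ numeral n
numeral-cons b n = trans (cong (λ k → numeral (digitValue b + 2 * k)) (sym (value-numeral n)))
                         (numeral-value (b ∷ numeral n))

letterNumeral : ℕ → List Letter
letterNumeral n = map digitLetter (numeral n)

-- One step of serial multiplication: `t` is the carry after a digit has been added and `2 * x` the
-- share of the later digits, so the last digit of `t` is final and `half t` is carried on.
numeral-carry : ∀ t x → 1 ≤ t → letterNumeral (t + 2 * x) ≡ letterOf (dig t) ∷ letterNumeral (half t + x)
numeral-carry t x t≥1 with split t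
... | zero = ⊥-elim (1+n≰n t≥1)
... | cons b k = begin
  letterNumeral (digitValue b + 2 * k + 2 * x)  ≡⟨ cong letterNumeral (eq (digitValue b) k x) ⟩
  letterNumeral (digitValue b + 2 * (k + x))    ≡⟨ cong (map digitLetter) (numeral-cons b (k + x)) ⟩
  digitLetter b ∷ letterNumeral (k + x)         ≡⟨ cong₂ (λ d h → letterOf d ∷ letterNumeral (h + x)) (sym (dig-cons b k)) (sym (half-cons b k)) ⟩
  _ ∎
  where
  open ≡-Reasoning
  eq : ∀ d k x → d + 2 * k + 2 * x ≡ d + 2 * (k + x)
  eq = solve-∀

-- Sequences of rounds

data Rounds (bs : List (Fin 2)) : ℕ → Stage → Stage → Set where
  none  : ∀ {S} → Rounds bs 0 S S
  round : ∀ {r S S′ S″} → Steps (roundCost (size bs S)) (zipper bs S) (zipper bs S′) →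
          size bs S′ ≡ suc (size bs S) → Rounds bs r S′ S″ → Rounds bs (suc r) S S″

roundsCost : ℕ → ℕ → ℕ
roundsCost zero    z = 0
roundsCost (suc r) z = roundCost z + roundsCost r (suc z)

rounds-Steps : ∀ {bs r S S′} → Rounds bs r S S′ → Steps (roundsCost r (size bs S)) (zipper bs S) (zipper bs S′)
rounds-Steps none            = finish
rounds-Steps {bs} {suc r} (round s eq rs) = s ⨾ recount (cong (roundsCost r) eq) (rounds-Steps rs)

rounds-size : ∀ {bs r S S′} → Rounds bs r S S′ → size bs S′ ≡ r + size bs S
rounds-size none            = refl
rounds-size {r = suc r} (round s eq rs) = trans (rounds-size rs) (trans (cong (_+_ r) eq) (+-suc r _))

infixr 5 _⨾ʳ_
_⨾ʳ_ : ∀ {bs r r′ S S′ S″} → Rounds bs r S S′ → Rounds bs r′ S′ S″ → Rounds bs (r + r′) S S″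
none          ⨾ʳ t = t
round s eq rs ⨾ʳ t = round s eq (rs ⨾ʳ t)

recast : ∀ {bs r r′ S S′ T T′} → r ≡ r′ → S ≡ S′ → T ≡ T′ → Rounds bs r S T → Rounds bs r′ S′ T′
recast refl refl refl rs = rs

-- Length of the output and running time

periodLetters : List ℕ → List Letter
periodLetters = concatMap (λ p → ℓsep ∷ letterNumeral p)

-- The least numeral of a given length consists of digits 1 only.
2^length≤1+value : ∀ ds → 2 ^ length ds ≤ suc (value ds)
2^length≤1+value []       = ≤-refl
2^length≤1+value (b ∷ ds) = begin
  2 * 2 ^ length ds      ≤⟨ *-monoʳ-≤ 2 (2^length≤1+value ds) ⟩
  2 * suc (value ds)     ≡⟨ *-suc 2 (value ds) ⟩
  2 + 2 * value ds       ≤⟨ s≤s (+-monoˡ-≤ (2 * value ds) (s≤s (z≤n {toℕ b}))) ⟩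
  suc (value (b ∷ ds))   ∎
  where open ≤-Reasoning

-- The greatest numeral of a given length consists of digits 2 only.
2+value≤2^1+length : ∀ ds → 2 + value ds ≤ 2 ^ suc (length ds)
2+value≤2^1+length []       = ≤-refl
2+value≤2^1+length (b ∷ ds) = begin
  2 + (digitValue b + 2 * value ds) ≤⟨ s≤s (s≤s (+-monoˡ-≤ (2 * value ds) (digitValue≤2 b))) ⟩
  4 + 2 * value ds                  ≡⟨ *-distribˡ-+ 2 2 (value ds) ⟨
  2 * (2 + value ds)                ≤⟨ *-monoʳ-≤ 2 (2+value≤2^1+length ds) ⟩
  2 ^ suc (length (b ∷ ds))         ∎
  where open ≤-Reasoning

-- A longer numeral would contradict the two preceding bounds, by comparison of powers of 2.
length-numeral-* : ∀ bs p → length (numeral (value bs * p)) < suc (length bs) + suc (length (numeral p))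
length-numeral-* bs p = ≰⇒> λ le → <⇒≱ bound (^-monoʳ-≤ 2 le)
  where
  open ≤-Reasoning
  ds = numeral p
  expand : ∀ v w → suc (v * w) < (2 + v) * (2 + w)
  expand v w = ≤-trans (m≤m+n _ (2 + 2 * v + 2 * w)) (≤-reflexive (eq v w))
    where
    eq : ∀ v w → suc (suc (v * w)) + (2 + 2 * v + 2 * w) ≡ (2 + v) * (2 + w)
    eq = solve-∀
  bound : 2 ^ length (numeral (value bs * p)) < 2 ^ (suc (length bs) + suc (length ds))
  bound = begin-strict
    2 ^ length (numeral (value bs * p))            ≤⟨ 2^length≤1+value (numeral (value bs * p)) ⟩
    suc (value (numeral (value bs * p)))           ≡⟨ cong suc (trans (value-numeral (value bs * p)) (cong (value bs *_) (sym (value-numeral p)))) ⟩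
    suc (value bs * value ds)                      <⟨ expand (value bs) (value ds) ⟩
    (2 + value bs) * (2 + value ds)                ≤⟨ *-mono-≤ (2+value≤2^1+length bs) (2+value≤2^1+length ds) ⟩
    2 ^ suc (length bs) * 2 ^ suc (length ds)      ≡⟨ ^-distribˡ-+-* 2 (suc (length bs)) (suc (length ds)) ⟨
    2 ^ (suc (length bs) + suc (length ds))        ∎

length-periodLetters-* : ∀ bs ps → length (periodLetters (map (value bs *_) ps)) ≤ length (periodLetters ps) * (2 + length bs)
length-periodLetters-* bs []       = z≤n
length-periodLetters-* bs (p ∷ ps) = begin
  suc (length (letterNumeral (value bs * p) ++ periodLetters (map (value bs *_) ps)))
    ≡⟨ cong suc (trans (length-++ (letterNumeral (value bs * p))) (cong (_+ rest) (length-map digitLetter (numeral (value bs * p))))) ⟩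
  suc (length (numeral (value bs * p))) + rest
    ≤⟨ +-mono-≤ (length-numeral-* bs p) (length-periodLetters-* bs ps) ⟩
  suc b + suc d + length (periodLetters ps) * (2 + b)
    ≤⟨ +-monoˡ-≤ (length (periodLetters ps) * (2 + b)) (expand b d) ⟩
  suc d * (2 + b) + length (periodLetters ps) * (2 + b)
    ≡⟨ *-distribʳ-+ (2 + b) (suc d) (length (periodLetters ps)) ⟨
  (suc d + length (periodLetters ps)) * (2 + b)
    ≡⟨ cong (λ l → suc l * (2 + b)) (trans (cong (_+ length (periodLetters ps)) (sym (length-map digitLetter (numeral p)))) (sym (length-++ (letterNumeral p)))) ⟩
  length (periodLetters (p ∷ ps)) * (2 + b) ∎
  where
  open ≤-Reasoning
  b = length bs
  d = length (numeral p)
  rest = length (periodLetters (map (value bs *_) ps))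
  expand : ∀ b d → suc b + suc d ≤ suc d * (2 + b)
  expand b d = ≤-trans (m≤m+n _ (d * b + d)) (≤-reflexive (eq b d))
    where
    eq : ∀ b d → suc b + suc d + (d * b + d) ≡ suc d * (2 + b)
    eq = solve-∀

roundsCost-≤ : ∀ r z → roundsCost r z ≤ r * roundCost (z + r)
roundsCost-≤ zero    z = z≤n
roundsCost-≤ (suc r) z = +-mono-≤
  (+-monoˡ-≤ 4 (*-monoʳ-≤ 2 (m≤m+n z (suc r))))
  (≤-trans (roundsCost-≤ r (suc z)) (≤-reflexive (cong (λ y → r * roundCost y) (sym (+-suc z r)))))

-- Loading, `r` rounds and the final seek are added up. Quadratically many rounds on a tape of at
-- most quadratic length give degree 4.
total-≤ : ∀ n r → r ≤ (2 + n) * (2 + n) → roundCost n + 2 + (roundsCost r (suc n) + (r + suc n + 2)) ≤ 5 * (2 + n) ^ 4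
total-≤ n r r≤ = begin
  roundCost n + 2 + (roundsCost r (suc n) + (r + suc n + 2))
    ≤⟨ +-monoʳ-≤ (roundCost n + 2) (+-mono-≤ (≤-trans (roundsCost-≤ r (suc n)) (*-mono-≤ r≤ (+-monoˡ-≤ 4 (*-monoʳ-≤ 2 (+-monoʳ-≤ (suc n) r≤)))))
                                             (+-monoˡ-≤ 2 (+-monoˡ-≤ (suc n) r≤))) ⟩
  roundCost n + 2 + (R * roundCost (suc n + R) + (R + suc n + 2))
    ≤⟨ m≤m+n _ (slack n) ⟩
  _ ≡⟨ eq n ⟩
  5 * (2 + n) ^ 4 ∎
  where
  open ≤-Reasoning
  R = (2 + n) * (2 + n)
  -- The exact difference of the two sides, which reduces the inequality to a ring identity.
  slack : ℕ → ℕ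
  slack n = 3 * (n * n * n * n) + 22 * (n * n * n) + 57 * (n * n) + 57 * n + 11
  -- The powers and R are unfolded for the ring solver.
  eq : ∀ n → 2 * n + 4 + 2 + ((2 + n) * (2 + n) * (2 * (suc n + (2 + n) * (2 + n)) + 4) + ((2 + n) * (2 + n) + suc n + 2)) +
    (3 * (n * n * n * n) + 22 * (n * n * n) + 57 * (n * n) + 57 * n + 11) ≡
    5 * ((2 + n) * ((2 + n) * ((2 + n) * ((2 + n) * 1))))
  eq = solve-∀

2+n≤5*[2+n]^4 : ∀ n → 2 + n ≤ 5 * (2 + n) ^ 4
2+n≤5*[2+n]^4 n = begin
  2 + n            ≡⟨ *-identityʳ (2 + n) ⟨
  (2 + n) ^ 1      ≤⟨ ^-monoʳ-≤ (2 + n) (s≤s (z≤n {3})) ⟩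
  (2 + n) ^ 4      ≤⟨ m≤n*m ((2 + n) ^ 4) 5 ⟩
  5 * (2 + n) ^ 4  ∎
  where open ≤-Reasoning

-- Runs of the multiplication machine for positive m

module Multiplier (b₀ : Fin 2) (bs₀ : List (Fin 2)) where

  bs : List (Fin 2)
  bs = b₀ ∷ bs₀

  m : ℕ
  m = value bs

  -- `dispatch` performs the first column, with carry 0, and `addSweep` the others; `Column`
  -- identifies the results with the digit and half of `t`.
  digitRound : ∀ b {c n W} → c ≤ 2 * m + 3 → let t = c + digitValue b * m in
    Steps (roundCost (size bs (stage c n (digitLetter b ∷ W))))
      (zipper bs (stage c n (digitLetter b ∷ W)))
      (zipper bs (stage (half t) (suc n) (W ++ [ letterOf (dig t) ])))
  digitRound b {c} {n} {W} c≤ = recount (count (length bs₀) n (length W))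
    (retarget (cong (λ d → zipper bs (stage (half t) (suc n) (W ++ [ letterOf d ]))) dig≡)
      (advance (dispatch-digit b)
        (addSweep ℓ e pos bs₀ (half-small b₀ (value bs₀) c≤) (C.carry-≤ z≤n)
         ⨾ reload regs (consumeRound {e} {ℓ} bs t≤))))
    where
    ℓ = digitLetter b
    t = c + digitValue b * m
    mult : ∀ b → multiplier (digitLetter b) ≡ digitValue b
    mult 0F = refl
    mult 1F = refl
    pos : 1 ≤ multiplier ℓ
    pos = ≤-trans (s≤s z≤n) (≤-reflexive (sym (mult b)))
    module C = Column ℓ pos b₀ c (value bs₀) 0
    e = letterOf (dig (column ℓ b₀ c 0))
    total≡ : C.total ≡ t
    total≡ = trans (+-identityʳ _) (cong (λ d → c + d * m) (mult b))
    dig≡ : dig (column ℓ b₀ c 0) ≡ dig t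
    dig≡ = trans (sym C.dig-total) (cong dig total≡)
    half≡ : half c + multiplier ℓ * value bs₀ + half (column ℓ b₀ c 0) ≡ half t
    half≡ = trans (sym C.half-total) (cong half total≡)
    regs : registers bs t ʳ++ [ empty ] ≡
      registers bs₀ (half c + multiplier ℓ * value bs₀ + half (column ℓ b₀ c 0)) ʳ++ cell b₀ (dig (column ℓ b₀ c 0)) ∷ [ empty ]
    regs = cong₂ (λ d h → registers bs₀ h ʳ++ cell b₀ d ∷ [ empty ]) (sym dig≡) (sym half≡)
    dispatch-digit : ∀ b → let ℓ = digitLetter b in δ (dispatch ℓ) (cell b₀ (dig c)) ≡
      just (addAction ℓ (letterOf (dig (column ℓ b₀ c 0))) b₀ (dig c) 0)
    dispatch-digit 0F = refl
    dispatch-digit 1F = refl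
    t≤ : t ≤ 4 * m + 7
    t≤ = ≤-trans (+-mono-≤ c≤ (*-monoˡ-≤ m (digitValue≤2 b)))
           (≤-trans (≤-reflexive (eq m)) (+-monoʳ-≤ (4 * m) (m≤m+n 3 4)))
      where
      eq : ∀ v → 2 * v + 3 + 2 * v ≡ 4 * v + 3
      eq = solve-∀
    count : ∀ k n w → suc (suc k + (n + suc (w + (w + (suc n + (suc k + 3)))))) ≡ 2 * (suc k + (n + suc w)) + 4
    count = solve-∀

  skipRegisters : ∀ {q b y v ls rs} → (∀ b y → Passes q right (cell b y)) → (∀ h → Passes q right (overflow h)) →
    Steps (suc (length bs₀)) (q ∣ cell b y ∷ ls ∣ registers bs₀ v ++ rs) (q ∣ registers bs₀ v ʳ++ cell b y ∷ ls ∣ rs)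
  skipRegisters p p′ = recount (length-registers bs₀ _) (passRight (All-registers p p′ bs₀ _))

  -- As `c` is positive its lowest digit is not `0F`, so the end marker stays at the head of the
  -- queue while the digit is appended.
  flushRound : ∀ {ℓ c n W} → ℓ ≡ ℓsep ⊎ ℓ ≡ ℓ# → 1 ≤ c → c ≤ 2 * m + 3 →
    Steps (roundCost (size bs (stage c n (ℓ ∷ W))))
      (zipper bs (stage c n (ℓ ∷ W)))
      (zipper bs (stage (half c) n (ℓ ∷ W ++ [ letterOf (dig c) ])))
  flushRound {ℓ} {c} {n} {W} ends c≥1 c≤ = recount (count (length bs₀) n (length W))
    (advance (dispatch-flush ends)
      (skipRegisters {v = half c} (λ _ _ → refl) (λ _ → refl) ⨾
       skipUsed n refl ⨾ appendRound {letterOf (dig c)} bs {n} {ℓ ∷ W} c≤′))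
    where
    c≤′ : c ≤ 4 * m + 7
    c≤′ = ≤-trans c≤ (+-mono-≤ (*-monoˡ-≤ m (m≤m+n 2 2)) (m≤m+n 3 4))
    dispatch-flush : ∀ {ℓ} → ℓ ≡ ℓsep ⊎ ℓ ≡ ℓ# →
      δ (dispatch ℓ) (cell b₀ (dig c)) ≡ just (append (letterOf (dig c)) , cell b₀ (dig c) , right)
    dispatch-flush ends with split c
    dispatch-flush ends | zero = ⊥-elim (1+n≰n c≥1)
    dispatch-flush (inj₁ refl) | cons b k rewrite dig-cons b k = refl
    dispatch-flush (inj₂ refl) | cons b k rewrite dig-cons b k = refl
    count : ∀ k n w → suc (suc k + (n + (suc w + (suc w + (n + (suc k + 3)))))) ≡ 2 * (suc k + (n + suc w)) + 4
    count = solve-∀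

  sepRound : ∀ {n W} →
    Steps (roundCost (size bs (stage 0 n (ℓsep ∷ W))))
      (zipper bs (stage 0 n (ℓsep ∷ W)))
      (zipper bs (stage 0 (suc n) (W ++ [ ℓsep ])))
  sepRound {n} {W} = recount (count (length bs₀) n (length W))
    (advance refl
      (skipRegisters {v = 0} (λ _ _ → refl) (λ _ → refl) ⨾ consumeRound bs z≤n))
    where
    count : ∀ k n w → suc (suc k + (n + suc (w + (w + (suc n + (suc k + 3)))))) ≡ 2 * (suc k + (n + suc w)) + 4
    count = solve-∀

  finalSeek : ∀ {n W} → ∃ λ ls → Steps (length bs + n + 2) (zipper bs (stage 0 n (ℓ# ∷ W))) (done ∣ ls ∣ letters W)
  finalSeek {n} {W} = _ , recount (count (length bs₀) n)
    (advance refl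
      (skipRegisters {v = 0} (λ _ _ → refl) (λ _ → refl) ⨾
       skipUsed n refl ⨾ advance refl finish))
    where
    count : ∀ k n → suc (suc k + (n + 1)) ≡ suc k + n + 2
    count = solve-∀

  loading : ∀ W → Steps (roundCost (size bs (stage 0 0 W)) + 2)
    (start ∣ [ empty ] ∣ letters (map digitLetter bs ++ ℓsep ∷ W)) (zipper bs (stage 0 0 (W ++ ℓ# ∷ ℓsep ∷ [])))
  loading W = recount (count (length bs₀) (length W)) (first b₀ ⨾
     markQueue W ⨾ retarget target (recount (cong (_+ (length bs + 3)) (length-++ W)) (rewind bs 0 (W ++ [ ℓ# ]) z≤n)))
    where
    first : ∀ b₀ → Steps (suc (suc (length bs₀)))
      (start ∣ [ empty ] ∣ letters (map digitLetter (b₀ ∷ bs₀) ++ ℓsep ∷ W))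
      (mark ∣ registers (b₀ ∷ bs₀) 0 ʳ++ [ empty ] ∣ letters W)
    first 0F = advance refl (loadRegisters bs₀)
    first 1F = advance refl (loadRegisters bs₀)
    target : (dispatch (firstOr ℓsep (W ++ [ ℓ# ])) ∣ [ empty ] ∣ registers bs 0 ++ letters ((W ++ [ ℓ# ]) ++ [ ℓsep ])) ≡
             zipper bs (stage 0 0 (W ++ ℓ# ∷ ℓsep ∷ []))
    target = trans (cong (λ ℓ → dispatch ℓ ∣ [ empty ] ∣ registers bs 0 ++ letters ((W ++ [ ℓ# ]) ++ [ ℓsep ])) (firstOr-snoc ℓ# ℓsep (W ++ [ ℓ# ])))
                   (cong (λ V → zipper bs (stage 0 0 V)) (++-assoc W [ ℓ# ] [ ℓsep ]))
    count : ∀ k w → suc (suc k) + (w + 1 + (w + 1 + (suc k + 3))) ≡ 2 * (suc k + w) + 4 + 2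
    count = solve-∀

  private
    snoc-length : ∀ (W : List Letter) ℓ → length (W ++ [ ℓ ]) ≡ suc (length W)
    snoc-length W ℓ = trans (length-++ W) (+-comm (length W) 1)

    grow-consume : ∀ n ℓ W → length bs + (suc n + length (W ++ [ ℓ ])) ≡ suc (length bs + (n + suc (length W)))
    grow-consume n ℓ W = trans (cong (λ l → length bs + (suc n + l)) (snoc-length W ℓ)) (+-suc (length bs) _)

    grow-append : ∀ n ℓ W → length bs + (n + length (W ++ [ ℓ ])) ≡ suc (length bs + (n + length W))
    grow-append n ℓ W = trans (cong (λ l → length bs + (n + l)) (snoc-length W ℓ))
      (trans (cong (_+_ (length bs)) (+-suc n _)) (+-suc (length bs) _))

  -- The carry is given by its digits, which makes the flush structurally recursive.
  flush : ∀ ds {n ℓ W} → ℓ ≡ ℓsep ⊎ ℓ ≡ ℓ# → value ds ≤ 2 * m + 3 →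
    Rounds bs (length ds) (stage (value ds) n (ℓ ∷ W)) (stage 0 n (ℓ ∷ W ++ map digitLetter ds))
  flush [] {n} {ℓ} {W} ends le = recast refl refl (cong (λ V → stage 0 n (ℓ ∷ V)) (sym (++-identityʳ W))) none
  flush (b ∷ ds) {n} {ℓ} {W} ends le =
    round (flushRound ends (s≤s z≤n) le) (grow-append n (letterOf (dig (value (b ∷ ds)))) (ℓ ∷ W))
      (recast refl
        (cong₂ (λ c d → stage c n (ℓ ∷ W ++ [ letterOf d ])) (sym (half-cons b (value ds))) (sym (dig-cons b (value ds))))
        (cong (λ V → stage 0 n (ℓ ∷ V)) (++-assoc W [ digitLetter b ] (map digitLetter ds)))
        (flush ds ends (≤-trans (≤-trans (m≤m+n (value ds) (value ds + 0)) (m≤n+m (2 * value ds) (digitValue b))) le)))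

  -- Low digits first: each digit of the period yields one output letter, and `flush` emits the
  -- carry that is left. Hence there are as many rounds as output letters.
  multiply : ∀ ds {c n ℓ W} → ℓ ≡ ℓsep ⊎ ℓ ≡ ℓ# → c ≤ 2 * m + 3 →
    let out = letterNumeral (c + m * value ds) in
    ∃ λ n′ → Rounds bs (length out) (stage c n (map digitLetter ds ++ ℓ ∷ W)) (stage 0 n′ (ℓ ∷ W ++ out))
  multiply [] {c} {n} {ℓ} {W} ends c≤ = n ,
    recast (trans (sym (length-map digitLetter (numeral c))) (cong (λ x → length (letterNumeral x)) c≡))
      (cong (λ x → stage x n (ℓ ∷ W)) (value-numeral c)) (cong (λ x → stage 0 n (ℓ ∷ W ++ letterNumeral x)) c≡)
      (flush (numeral c) ends (≤-trans (≤-reflexive (value-numeral c)) c≤))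
    where
    c≡ : c ≡ c + m * 0
    c≡ = sym (trans (cong (_+_ c) (*-zeroʳ m)) (+-identityʳ c))
  multiply (b ∷ ds) {c} {n} {ℓ} {W} ends c≤ = n′ ,
    subst (λ out → Rounds bs (length out) (stage c n (digitLetter b ∷ V)) (stage 0 n′ (ℓ ∷ W ++ out))) (sym out≡)
      (round (digitRound b c≤) (grow-consume n e V)
        (recast refl (cong (stage (half t) (suc n)) (sym (++-assoc (map digitLetter ds) (ℓ ∷ W) [ e ])))
                     (cong (λ U → stage 0 n′ (ℓ ∷ U)) (++-assoc W [ e ] (letterNumeral (half t + m * value ds))))
                     rest))
    where
    V = map digitLetter ds ++ ℓ ∷ W
    t = c + digitValue b * m
    e = letterOf (dig t)
    t≥1 : 1 ≤ t
    t≥1 = ≤-trans (s≤s z≤n) (m≤n+m (digitValue b * m) c)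
    -- The invariant `2 * m + 3` is stable, since `t` is at most 4 m + 3 before it is halved.
    half-t≤ : half t ≤ 2 * m + 3
    half-t≤ = half-≤ t (2 * m + 3) (begin
      t                     ≤⟨ +-mono-≤ c≤ (*-monoˡ-≤ m (digitValue≤2 b)) ⟩
      2 * m + 3 + 2 * m     ≤⟨ m≤n+m _ 5 ⟩
      5 + (2 * m + 3 + 2 * m) ≡⟨ eq m ⟩
      2 + 2 * (2 * m + 3)   ∎)
      where
      open ≤-Reasoning
      eq : ∀ v → 5 + (2 * v + 3 + 2 * v) ≡ 2 + 2 * (2 * v + 3)
      eq = solve-∀
    ih   = multiply ds {half t} {suc n} {ℓ} {W ++ [ e ]} ends half-t≤
    n′   = proj₁ ih
    rest = proj₂ ih
    out≡ : letterNumeral (c + m * value (b ∷ ds)) ≡ e ∷ letterNumeral (half t + m * value ds)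
    out≡ = trans (cong letterNumeral (eq c m (digitValue b) (value ds))) (numeral-carry t (m * value ds) t≥1)
      where
      eq : ∀ c m d v → c + m * (d + 2 * v) ≡ c + d * m + 2 * (m * v)
      eq = solve-∀

  multiplyOne : ∀ p {n ℓ W} → ℓ ≡ ℓsep ⊎ ℓ ≡ ℓ# →
    let out = letterNumeral (m * p) in
    ∃ λ n′ → Rounds bs (length out) (stage 0 n (letterNumeral p ++ ℓ ∷ W)) (stage 0 n′ (ℓ ∷ W ++ out))
  multiplyOne p {n} {ℓ} {W} ends = subst (λ k → let out = letterNumeral (m * k) in
      ∃ λ n′ → Rounds bs (length out) (stage 0 n (letterNumeral p ++ ℓ ∷ W)) (stage 0 n′ (ℓ ∷ W ++ out)))
    (value-numeral p) (multiply (numeral p) ends z≤n)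

  -- The separator of `p` has already moved into `out`, so `new` begins with digits. Each later
  -- separator moves by a `sepRound` once the carry is empty.
  multiplyAll : ∀ ps p {n out} → let new = letterNumeral (m * p) ++ periodLetters (map (m *_) ps) in
    ∃ λ n′ → Rounds bs (length new) (stage 0 n (letterNumeral p ++ periodLetters ps ++ ℓ# ∷ out))
                                    (stage 0 n′ (ℓ# ∷ out ++ new))
  multiplyAll [] p {n} {out} with multiplyOne p {n} {ℓ#} {out} (inj₂ refl)
  ... | n′ , rs = n′ , recast (cong length new≡) refl (cong (λ new → stage 0 n′ (ℓ# ∷ out ++ new)) new≡) rs
    where
    new≡ : letterNumeral (m * p) ≡ letterNumeral (m * p) ++ []
    new≡ = sym (++-identityʳ (letterNumeral (m * p)))
  multiplyAll (p′ ∷ ps) p {n} {out} = n″ ,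
    recast (sym (length-++ new₁))
      (cong (λ V → stage 0 n (letterNumeral p ++ ℓsep ∷ V)) (sym (++-assoc (letterNumeral p′) (periodLetters ps) (ℓ# ∷ out))))
      refl
      (proj₂ first ⨾ʳ round sepRound size≡
        (recast refl (cong (stage 0 (suc n′)) source) (cong (λ V → stage 0 n″ (ℓ# ∷ V)) target) (proj₂ ih)))
    where
    new₁  = letterNumeral (m * p)
    W     = letterNumeral p′ ++ periodLetters ps ++ ℓ# ∷ out
    first = multiplyOne p {n} {ℓsep} {W} (inj₁ refl)
    n′    = proj₁ first
    out′  = out ++ new₁ ++ [ ℓsep ]
    ih    = multiplyAll ps p′ {suc n′} {out′}
    n″    = proj₁ ih
    size≡ : size bs (stage 0 (suc n′) ((W ++ new₁) ++ [ ℓsep ])) ≡ suc (size bs (stage 0 n′ (ℓsep ∷ W ++ new₁)))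
    size≡ = trans (cong (λ l → length bs + (suc n′ + l)) (trans (length-++ (W ++ new₁)) (+-comm _ 1))) (+-suc (length bs) _)
    source : letterNumeral p′ ++ periodLetters ps ++ ℓ# ∷ out′ ≡ (W ++ new₁) ++ [ ℓsep ]
    source = trans
      (cong (letterNumeral p′ ++_) (trans
        (cong (λ V → periodLetters ps ++ ℓ# ∷ V) (sym (++-assoc out new₁ [ ℓsep ])))
        (trans (sym (++-assoc (periodLetters ps) (ℓ# ∷ out ++ new₁) [ ℓsep ]))
               (cong (_++ [ ℓsep ]) (sym (++-assoc (periodLetters ps) (ℓ# ∷ out) new₁))))))
      (trans (sym (++-assoc (letterNumeral p′) _ [ ℓsep ]))
             (cong (_++ [ ℓsep ]) (sym (++-assoc (letterNumeral p′) (periodLetters ps ++ ℓ# ∷ out) new₁))))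
    target : out′ ++ letterNumeral (m * p′) ++ periodLetters (map (m *_) ps) ≡
             out ++ new₁ ++ ℓsep ∷ letterNumeral (m * p′) ++ periodLetters (map (m *_) ps)
    target = trans (++-assoc out (new₁ ++ [ ℓsep ]) _) (cong (out ++_) (++-assoc new₁ [ ℓsep ] _))

  run-nonempty : ∀ p ps → let n = length bs + length (periodLetters (p ∷ ps)) in
    ∃ λ t → t ≤ 5 * (2 + n) ^ 4 × ∃ λ ls → Steps t
      (start ∣ [ empty ] ∣ letters (map digitLetter bs ++ periodLetters (p ∷ ps)))
      (done ∣ ls ∣ letters (periodLetters (map (m *_) (p ∷ ps))))
  run-nonempty p ps = t , t≤ , ls ,
    (loading W ⨾ recount (cong (roundsCost r) size≡) (rounds-Steps rounds) ⨾ proj₂ finalSeek)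
    where
    W   = letterNumeral p ++ periodLetters ps
    new = letterNumeral (m * p) ++ periodLetters (map (m *_) ps)
    r   = length new
    n   = length bs + suc (length W)
    -- The output starts with the separator written during loading.
    all = multiplyAll ps p {0} {[ ℓsep ]}
    n′  = proj₁ all
    rounds : Rounds bs r (stage 0 0 (W ++ ℓ# ∷ ℓsep ∷ [])) (stage 0 n′ (ℓ# ∷ ℓsep ∷ new))
    rounds = recast refl (cong (stage 0 0) (sym (++-assoc (letterNumeral p) (periodLetters ps) (ℓ# ∷ ℓsep ∷ [])))) refl (proj₂ all)
    ls  = proj₁ (finalSeek {n′} {ℓsep ∷ new})
    t   = roundCost (length bs + length W) + 2 + (roundsCost r (suc n) + (length bs + n′ + 2))
    size≡ : size bs (stage 0 0 (W ++ ℓ# ∷ ℓsep ∷ [])) ≡ suc n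
    size≡ = trans (cong (_+_ (length bs)) (length-++ W)) (eq (length bs) (length W))
      where
      eq : ∀ b w → b + (w + 2) ≡ suc (b + suc w)
      eq = solve-∀
    -- The used cells are part of the final tape, whose size is known from the number of rounds.
    used≤ : length bs + n′ ≤ r + suc n
    used≤ = ≤-trans (+-monoʳ-≤ (length bs) (m≤m+n n′ _)) (≤-reflexive (trans (rounds-size rounds) (cong (_+_ r) size≡)))
    r≤ : r ≤ (2 + n) * (2 + n)
    -- `new` is one letter shorter than the encoded output, as it lacks the first separator.
    r≤ = ≤-trans (n≤1+n r) (≤-trans (length-periodLetters-* bs (p ∷ ps))
           (*-mono-≤ (≤-trans (m≤n+m (suc (length W)) (length bs)) (m≤n+m n 2)) (+-monoʳ-≤ 2 (m≤m+n (length bs) (suc (length W))))))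
    t≤ : t ≤ 5 * (2 + n) ^ 4
    t≤ = ≤-trans (+-mono-≤ (+-monoˡ-≤ 2 (+-monoˡ-≤ 4 (*-monoʳ-≤ 2 (+-monoʳ-≤ (length bs) (n≤1+n (length W))))))
                           (+-monoʳ-≤ (roundsCost r (suc n)) (+-monoˡ-≤ 2 used≤)))
                 (total-≤ n r r≤)

-- From letters to words on the tape

letterCh : Ch → Letter
letterCh c0  = ℓ1
letterCh c1  = ℓ2
letterCh sep = ℓsep

word : List Ch → List Γ
word w = letters (map letterCh w)

-- In `Γ` the empty cell and the input letters come first and in the order of `Sym`, so the codes
-- agree by computation.
cellAt-word : ∀ w i → cellAt blank (map symOf w) i ≡ encΓ (cellAt empty (word w) i)
cellAt-word []        i       = refl
cellAt-word (c0 ∷ w)  zero    = refl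
cellAt-word (c1 ∷ w)  zero    = refl
cellAt-word (sep ∷ w) zero    = refl
cellAt-word (c ∷ w)   (suc i) = cellAt-word w i

initial-Represents : ∀ w → Represents (initial M w) (start ∣ [ empty ] ∣ word w)
initial-Represents w = record
  { state≡  = refl
  ; after≡  = λ i → trans (initTape-cellAt M w i) (cellAt-word w i)
  ; before≡ = λ { zero → refl ; (suc i) → refl } }

-- Agreement is required only up to the blank that ends `v`: remains of the input may stand behind
-- it.
computes : ∀ w v {s q ls rs T U} → map letterCh w ≡ U →
  Steps s (start ∣ [ empty ] ∣ letters U) (q ∣ ls ∣ rs) → δ q (headΓ rs) ≡ nothing →
  (∀ i → i ≤ length v → cellAt empty rs i ≡ cellAt empty (word v) i) → s ≤ T → ComputesWithin M w v T
computes w v {s} {q} {ls} {rs} refl steps halts agrees s≤T =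
  s , s≤T , trans (TM-δ rep) (cong (Maybe.map encodeAction) halts) ,
  outputIs-intro M (Config.state final) (Config.tape final) (Config.pos final) v
    (λ i i≤ → trans (Represents.after≡ rep i) (trans (cong encΓ (agrees i i≤)) (sym (cellAt-word v i))))
  where
  final : Config M
  final = run M s (initial M w)
  rep : Represents final (q ∣ ls ∣ rs)
  rep = run-Represents steps (initial-Represents w)

letters-encBin : ∀ x → map letterCh (encBin x) ≡ map digitLetter (bits x)
letters-encBin zeroᵇ    = refl
letters-encBin 1+[2 x ] = cong (ℓ1 ∷_) (letters-encBin x)
letters-encBin 2[1+ x ] = cong (ℓ2 ∷_) (letters-encBin x)

letters-encPeriods : ∀ ps → map letterCh (encPeriods ps) ≡ periodLetters ps
letters-encPeriods []       = refl
letters-encPeriods (p ∷ ps) = cong (ℓsep ∷_) (trans (map-++ letterCh (encNat p) (encPeriods ps))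
  (cong₂ _++_ (letters-encBin (toBin p)) (letters-encPeriods ps)))

letters-encMulti : ∀ m ps → map letterCh (encMulti m ps) ≡ letterNumeral m ++ periodLetters ps
letters-encMulti m ps = trans (map-++ letterCh (encNat m) (encPeriods ps))
  (cong₂ _++_ (letters-encBin (toBin m)) (letters-encPeriods ps))

-- The reduction

ReductionOf : ℕ → List ℕ → Set
ReductionOf m ps = Σ (List ℕ) λ ps′ →
  ComputesWithin M (encMulti m ps) (encSingle ps′) (5 * (2 + length (encMulti m ps)) ^ 4)
  × (MultiFeasible m ps → SingleFeasible ps′)
  × (SingleFeasible ps′ → MultiFeasible m ps)

-- Without machines only the empty instance is feasible. Any other one is sent to `[ 0 ]`, which is
-- infeasible because periods must be positive.
reduction-zero : ∀ ps → ReductionOf 0 ps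
reduction-zero [] = [] , computes (encMulti 0 []) [] refl finish refl (λ _ _ → refl) z≤n , feasible , feasible
  where
  feasible : ∀ {m n} → MultiFeasible m [] → MultiFeasible n []
  feasible _ = record { machine = λ () ; start = λ () } , [] , λ ()
reduction-zero (p ∷ ps) = [ 0 ] ,
  computes (encMulti 0 (p ∷ ps)) [ sep ] refl (advance refl (advance refl finish)) refl
    (λ { 0 _ → refl ; 1 _ → refl ; (suc (suc _)) (s≤s ()) })
    (≤-trans (m≤m+n 2 _) (2+n≤5*[2+n]^4 (length (encMulti 0 (p ∷ ps))))) ,
  (λ (S , _) → noMachine (Schedule.machine S zero)) , λ { (_ , () ∷ _ , _) }
  where
  noMachine : Fin 0 → SingleFeasible [ 0 ]
  noMachine ()

computes-scaled : ∀ m ps b₀ bs₀ → numeral m ≡ b₀ ∷ bs₀ →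
  ComputesWithin M (encMulti m ps) (encSingle (map (m *_) ps)) (5 * (2 + length (encMulti m ps)) ^ 4)
computes-scaled m ps b₀ bs₀ m≡ = go ps
  where
  bs = b₀ ∷ bs₀
  input≡ : ∀ ps → map letterCh (encMulti m ps) ≡ map digitLetter bs ++ periodLetters ps
  input≡ ps = trans (letters-encMulti m ps) (cong (λ ds → map digitLetter ds ++ periodLetters ps) m≡)
  length≡ : ∀ ps → length bs + length (periodLetters ps) ≡ length (encMulti m ps)
  length≡ ps = begin
    length bs + length (periodLetters ps)                   ≡⟨ cong (_+ length (periodLetters ps)) (length-map digitLetter bs) ⟨
    length (map digitLetter bs) + length (periodLetters ps) ≡⟨ length-++ (map digitLetter bs) ⟨
    length (map digitLetter bs ++ periodLetters ps)         ≡⟨ cong length (input≡ ps) ⟨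
    length (map letterCh (encMulti m ps))                   ≡⟨ length-map letterCh (encMulti m ps) ⟩
    length (encMulti m ps)                                  ∎
    where open ≡-Reasoning
  value≡ : value bs ≡ m
  value≡ = trans (cong value (sym m≡)) (value-numeral m)
  within : ∀ {t} ps → t ≤ 5 * (2 + (length bs + length (periodLetters ps))) ^ 4 → t ≤ 5 * (2 + length (encMulti m ps)) ^ 4
  within {t} ps = subst (λ n → t ≤ 5 * (2 + n) ^ 4) (length≡ ps)
  output≡ : ∀ ps → periodLetters (map (value bs *_) ps) ≡ map letterCh (encSingle (map (m *_) ps))
  output≡ ps = trans (cong (λ k → periodLetters (map (k *_) ps)) value≡) (sym (letters-encPeriods (map (m *_) ps)))
  go : ∀ ps → ComputesWithin M (encMulti m ps) (encSingle (map (m *_) ps)) (5 * (2 + length (encMulti m ps)) ^ 4)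
  go [] = computes (encMulti m []) [] (trans (input≡ []) (++-identityʳ (map digitLetter bs)))
    (proj₂ (run-empty b₀ bs₀)) refl (λ _ _ → refl)
    (within [] (≤-trans (≤-trans (m≤m+n (length bs) 0) (m≤n+m _ 2)) (2+n≤5*[2+n]^4 (length bs + 0))))
  go (p ∷ ps) = let (t , t≤ , ls , steps) = Multiplier.run-nonempty b₀ bs₀ p ps in
    computes (encMulti m (p ∷ ps)) (encSingle (map (m *_) (p ∷ ps))) (input≡ (p ∷ ps)) steps refl
      (λ i _ → cong (λ V → cellAt empty (letters V) i) (output≡ (p ∷ ps))) (within (p ∷ ps) t≤)

reduction : ∀ m ps → ReductionOf m ps
reduction zero      ps = reduction-zero ps
reduction m@(suc _) ps = byDigits (numeral m) refl
  where
  byDigits : ∀ bs → numeral m ≡ bs → ReductionOf m ps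
  byDigits []         m≡ = ⊥-elim (1+n≢0 (trans (sym (value-numeral m)) (cong value m≡)))
  byDigits (b₀ ∷ bs₀) m≡ =
    map (m *_) ps , computes-scaled m ps b₀ bs₀ m≡ , multi⇒single m ps , single⇒multi m ps

theorem5 : PolyTimeReduction
theorem5 = M , 5 , 4 , reduction
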